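{- Let $L$ be a multiset of odd integers greater than $1$, let $a\in\{0,1\}$, and set $\epsilon_1=7^{|L|+a-1}\big(2\max(L)+1\big)$ if $L\ne\emptyset$ and $\epsilon_1=3$ if $L=\emptyset$. Then there exists $\epsilon\in\mathcal{I}\!\left(\sum_{\ell\in L}\ell+2a+1,\ \epsilon_1\right)$ such that $\left[L,{}^a2\ \middle|\ \epsilon-\sum_{\ell\in L}\ell-2a\right]_\epsilon$ has a $\mathcal{GL}(x,y)$ with $0\le x\le\frac{\epsilon-1}{2}$ and $x<y$.
   Context: $\mathcal{I}(a,b)=\{x\in\mathbb{Z}\mid a\le x\le b\}$; $|L|$ counts multiplicity. For a multiset $L$ of integers $\ge 2$ and $m\ge 0$, $[L\mid m]$ is the vertex-disjoint union of one $\ell$-cycle for each $\ell\in L$ and a path with $m$ edges; $[L,{}^a2\mid m]$ means $L$ together with $a$ copies of $2$ (a $2$-cycle being two vertices joined by two parallel edges); the subscript $\epsilon$ is the number of edges. A labeling is an isomorphic copy with distinct integer vertices; $\Delta\Gamma$ is the multiset of differences $u-w$ over ordered pairs of adjacent vertices (parallel edges counted separately). A $\mathcal{GL}(x,y)$ of such a graph with $\epsilon$ edges and at most one $2$-cycle is a labeling $\Gamma$ with vertex set $\mathcal{I}(0,\epsilon)$, path end-vertices $x$ and $y$, and $\Delta\Gamma=\pm\mathcal{I}(1,\epsilon)$ if there is no $2$-cycle, $\Delta\Gamma=\pm\{1,3,3\}\cup\pm\mathcal{I}(4,\epsilon)$ (as multisets) if there is exactly one $2$-cycle. -}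

module Defs where

open import Data.Nat using (ℕ; zero; suc; _+_; _*_; _∸_; _⊔_)
open import Data.Integer as ℤ using (ℤ; +_)
open import Data.List using (List; []; _∷_; [_]; _++_; map; concat; concatMap; applyUpTo; upTo; replicate; length; head; last; foldr)
open import Data.Maybe using (just)
open import Data.Nat.ListAction using (sum)
open import Data.Product using (∃)
open import Data.List.Relation.Binary.Permutation.Propositional using (_↭_)
open import Relation.Binary.PropositionalEquality using (_≡_)

-- Labels are natural numbers: in a GL the vertex set is I(0,ε) ⊆ ℕ.
-- Signed difference u - w of two labels, as an integer.
diff : ℕ → ℕ → ℤ
diff u w = (+ u) ℤ.- (+ w)

pathΔ : List ℕ → List ℤ
pathΔ (u ∷ w ∷ r) = diff u w ∷ diff w u ∷ pathΔ (w ∷ r)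
pathΔ _ = []

-- Differences of the cycle with cyclic vertex sequence v₀ … v_{ℓ-1}
-- (edges v_i v_{i+1} and v_{ℓ-1} v₀). For ℓ = 2 this yields the two
-- parallel edges of a 2-cycle, each counted separately.
cycleΔ : List ℕ → List ℤ
cycleΔ [] = []
cycleΔ (v ∷ vs) = pathΔ (v ∷ vs ++ [ v ])

pm : ℕ → List ℤ
pm k = + k ∷ ℤ.- (+ k) ∷ []

-- ±I(lo,hi) as a multiset (empty if hi < lo)
pmRange : ℕ → ℕ → List ℤ
pmRange lo hi = concatMap (λ i → pm (lo + i)) (upTo (suc hi ∸ lo))

-- Required difference multiset of a GL with ε edges and a 2-cycles (a ≤ 1):
-- a = 0 : ±I(1,ε);  a = 1 : ±{1,3,3} ∪ ±I(4,ε).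
targetΔ : ℕ → ℕ → List ℤ
targetΔ zero ε = pmRange 1 ε
targetΔ (suc _) ε = pm 1 ++ pm 3 ++ pm 3 ++ pmRange 4 ε

edges : List ℕ → ℕ → ℕ → ℕ
edges L a m = sum L + 2 * a + m

-- A GL(x,y) of the graph [L, ^a 2 | m] (intended for a ≤ 1).
-- A labeling is given by the vertex sequences of the cycles (one per element
-- of L, in order), of the a 2-cycles, and of the path (m edges, m+1 vertices),
-- from endpoint x to endpoint y. The vertex set being I(0,ε) with all vertices
-- distinct is expressed by: all vertex labels together form a permutation of
-- 0,1,…,ε.
record GL (L : List ℕ) (a m x y : ℕ) : Set where
  field
    cycles     : List (List ℕ)
    cyclesLen  : map length cycles ≡ L
    twoCycles  : List (List ℕ)
    twoLen     : map length twoCycles ≡ replicate a 2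
    path       : List ℕ
    pathLen    : length path ≡ suc m
    pathStart  : head path ≡ just x
    pathEnd    : last path ≡ just y
    vertexSet  : concat cycles ++ concat twoCycles ++ path ↭ upTo (suc (edges L a m))
    diffs      : concatMap cycleΔ cycles ++ concatMap cycleΔ twoCycles ++ pathΔ path
                   ↭ targetΔ a (edges L a m)

maxL : List ℕ → ℕ
maxL = foldr _⊔_ 0

eps1 : List ℕ → ℕ → ℕ
eps1 [] a = 3
eps1 L@(_ ∷ _) a = 7 Data.Nat.^ (length L + a ∸ 1) * (2 * maxL L + 1)

Odd : ℕ → Set
Odd n = ∃ λ k → n ≡ 2 * k + 1

{-# OPTIONS --safe #-}
module Submission where

-- Cycles are added one at a time. A labelling Γ with ε edges is shifted into the middle of a longer range of
-- labels, so that the new vertices form a lower and an upper interval around it, and the new distances are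
-- those greater than ε. A zigzag between a lower and an equally long upper interval uses every distance of
-- an interval, so nested pairs of intervals use all the distances apart from one between consecutive pairs;
-- those serve as links. An odd cycle needs one edge inside the lower interval, hence of length greater than
-- ε. Balancing the links shows that the path must be entered at a position depending on its old end x, so
-- one pair needs a zigzag that starts at a prescribed vertex; such walks exist for intervals of equal length
-- (block). Equal length forces ε + k to be odd for a new cycle of length 2 k + 1, and the parity of the new
-- number of edges can be chosen freely by adding one more vertex. The construction needs k ≤ x, which persists
-- once the longest cycle has been added first; for a = 0 that first cycle needs a shorter construction of its
-- own, and for a = 1 it is added to a labelling of the 2-cycle and a path.

open import Defs
open import Data.Nat using (ℕ; zero; suc; _+_; _*_; _^_; _∸_; _≤_; _<_; ∣_-_∣; z≤n; s≤s; compare; less; equal; greater)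
open import Data.Nat.Properties
open import Data.Nat.Tactic.RingSolver using (solve-∀)
import Data.Integer.Properties as ℤ
open import Data.List using (List; []; _∷_; [_]; _++_; map; concat; concatMap; upTo; applyUpTo; replicate; length; last; take; drop)
open import Data.List.Properties using (++-assoc; ++-identityʳ; concat-map; concat-++; concatMap-++; map-++; map-id; map-∘; length-map; length-++; take++drop≡id)
open import Data.Maybe using (just)
open import Data.Nat.ListAction using (sum)
open import Data.List.Relation.Unary.All as All using (All; []; _∷_)
import Data.List.Relation.Unary.All.Properties as All
open import Data.List.Relation.Binary.Permutation.Propositional
  using (_↭_; ↭-refl; ↭-sym; ↭-trans; ↭-reflexive; prep; swap)
open import Data.List.Relation.Binary.Permutation.Propositional.Properties
  using (++⁺; ++⁺ˡ; ++⁺ʳ; map⁺; ++-comm; ↭-length; All-resp-↭; ↭-map-inv; shifts)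
open import Data.Product using (Σ; ∃; _×_; _,_; proj₁; proj₂)
open import Data.Sum using (_⊎_; inj₁; inj₂)
open import Relation.Nullary using (contradiction)
open import Relation.Binary.PropositionalEquality using (_≡_; refl; sym; trans; cong; cong₂; subst)

-- Multisets of integers as lists of intervals

range : ℕ → ℕ → List ℕ
range s zero    = []
range s (suc n) = s ∷ range (suc s) n

range-++ : ∀ s m n → range s m ++ range (s + m) n ≡ range s (m + n)
range-++ s zero    n = cong (λ t → range t n) (+-identityʳ s)
range-++ s (suc m) n = cong (s ∷_) (trans (cong (λ t → range (suc s) m ++ range t n) (+-suc s m)) (range-++ (suc s) m n))

map-+-range : ∀ c s n → map (c +_) (range s n) ≡ range (c + s) n
map-+-range c s zero    = refl
map-+-range c s (suc n) = cong (c + s ∷_) (trans (map-+-range c (suc s) n) (cong (λ t → range t n) (+-suc c s)))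

length-range : ∀ s n → length (range s n) ≡ n
length-range s zero    = refl
length-range s (suc n) = cong suc (length-range (suc s) n)

-- A pair (s , n) stands for the integers s, …, s + n ∸ 1.
Intervals : Set
Intervals = List (ℕ × ℕ)

⟦_⟧ : Intervals → List ℕ
⟦ [] ⟧          = []
⟦ (s , n) ∷ I ⟧ = range s n ++ ⟦ I ⟧

⟦⟧-++ : ∀ I J → ⟦ I ++ J ⟧ ≡ ⟦ I ⟧ ++ ⟦ J ⟧
⟦⟧-++ []            J = refl
⟦⟧-++ ((s , n) ∷ I) J = trans (cong (range s n ++_) (⟦⟧-++ I J)) (sym (++-assoc (range s n) ⟦ I ⟧ ⟦ J ⟧))

pull : ℕ → ℕ × ℕ → Intervals → (ℕ × ℕ) × Intervals
pull (suc i) x (y ∷ I) = let z , J = pull i y I in z , x ∷ J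
pull _       x I       = x , I

pull-↭ : ∀ i x I → ⟦ x ∷ I ⟧ ↭ ⟦ proj₁ (pull i x I) ∷ proj₂ (pull i x I) ⟧
pull-↭ (suc i) (s , n) (y ∷ I) with pull i y I | pull-↭ i y I
... | (t , m) , J | p = ↭-trans (++⁺ˡ (range s n) p) (shifts (range s n) (range t m))
pull-↭ zero    x I  = ↭-refl
pull-↭ (suc i) x [] = ↭-refl

-- Each index is relative to the intervals that have not been chosen yet.
arrange : List ℕ → Intervals → Intervals
arrange (i ∷ is) (x ∷ I) = let y , J = pull i x I in y ∷ arrange is J
arrange _        I       = I

arrange-↭ : ∀ is I → ⟦ I ⟧ ↭ ⟦ arrange is I ⟧
arrange-↭ (i ∷ is) (x ∷ I) with pull i x I | pull-↭ i x I
... | (t , m) , J | p = ↭-trans p (++⁺ˡ (range t m) (arrange-↭ is J))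
arrange-↭ []       I  = ↭-refl
arrange-↭ (i ∷ is) [] = ↭-refl

Consecutive : ℕ → ℕ → Intervals → Set
Consecutive s e []            = s ≡ e
Consecutive s e ((t , n) ∷ I) = t ≡ s × Consecutive (t + n) e I

consecutive : ∀ s n I → Consecutive s (s + n) I → ⟦ I ⟧ ≡ range s n
-- The recursion sees only the two endpoints, so it produces a length `m`; cancelling `s` identifies
-- it with `n`.
consecutive s n I c = let m , e , r = go s (s + n) I c in trans r (cong (range s) (+-cancelˡ-≡ s m n e))
  where
  go : ∀ s e I → Consecutive s e I → ∃ λ m → s + m ≡ e × ⟦ I ⟧ ≡ range s m
  go s e []            p          = 0 , trans (+-identityʳ s) p , refl
  go s e ((_ , n) ∷ I) (refl , c) =
    let m , p , r = go (s + n) e I c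
    in n + m , trans (sym (+-assoc s n m)) p , trans (cong (range s n ++_) r) (range-++ s n m)

-- As a record, it lets unification recover `I` and `J`; `⟦_⟧` is not injective.
record _≈_ (I J : Intervals) : Set where
  constructor same
  field sameElements : ⟦ I ⟧ ↭ ⟦ J ⟧

≈-refl : ∀ {I} → I ≈ I
≈-refl = same ↭-refl

-- The indices `is` sort the intervals; it remains to check that each begins where its predecessor
-- stops, by `refl` or an arithmetic identity.
merge₁ : ∀ is {I s n} → Consecutive s (s + n) (arrange is I) → I ≈ ((s , n) ∷ [])
merge₁ is {I} {s} {n} c = same (↭-trans (arrange-↭ is I)
  (↭-reflexive (trans (consecutive s n (arrange is I) c) (sym (++-identityʳ (range s n))))))

merge₂ : ∀ is k {I s n t m} → Consecutive s (s + n) (take k (arrange is I)) → Consecutive t (t + m) (drop k (arrange is I)) →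
  I ≈ ((s , n) ∷ (t , m) ∷ [])
merge₂ is k {I} {s} {n} {t} {m} c d = same (↭-trans (arrange-↭ is I) (↭-reflexive
  (trans (trans (cong ⟦_⟧ (sym (take++drop≡id k J))) (⟦⟧-++ (take k J) (drop k J)))
    (cong₂ _++_ (consecutive s n (take k J) c) (trans (consecutive t m (drop k J) d) (sym (++-identityʳ (range t m))))))))
  where J = arrange is I

-- Walks with prescribed vertices and distances

-- The additive form turns each link between walks into a polynomial identity for the ring solver.
data Distance (u v d : ℕ) : Set where
  up   : u + d ≡ v → Distance u v d
  down : v + d ≡ u → Distance u v d

distance : ∀ {u v d} → Distance u v d → ∣ u - v ∣ ≡ d
distance {u} {d = d} (up refl)   = ∣m-m+n∣≡n u d
distance {v = v} {d} (down refl) = trans (∣-∣-comm (v + d) v) (∣m-m+n∣≡n v d)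

endOf : ℕ → List ℕ → ℕ
endOf u []      = u
endOf u (w ∷ t) = endOf w t

-- Distances stay unsigned throughout the construction; `concatMap pm` restores both signs at the
-- end.
steps : ℕ → List ℕ → List ℕ
steps u []      = []
steps u (w ∷ t) = ∣ u - w ∣ ∷ steps w t

endOf-++ : ∀ u t w r → endOf u (t ++ w ∷ r) ≡ endOf w r
endOf-++ u []      w r = refl
endOf-++ u (z ∷ t) w r = endOf-++ z t w r

steps-++ : ∀ u t w r → steps u (t ++ w ∷ r) ≡ steps u t ++ ∣ endOf u t - w ∣ ∷ steps w r
steps-++ u []      w r = refl
steps-++ u (z ∷ t) w r = cong (∣ u - z ∣ ∷_) (steps-++ z t w r)

record Path (u v : ℕ) (V D : Intervals) : Set where
  constructor mkPath
  field
    tail      : List ℕ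
    end       : endOf u tail ≡ v
    vertices  : u ∷ tail ↭ ⟦ V ⟧
    distances : steps u tail ↭ ⟦ D ⟧

cast : ∀ {u u′ v v′ V V′ D D′} → Path u v V D → u ≡ u′ → v ≡ v′ → V ≈ V′ → D ≈ D′ → Path u′ v′ V′ D′
cast (mkPath t e vs ds) refl refl (same p) (same q) = mkPath t e (↭-trans vs p) (↭-trans ds q)

single : ∀ u → Path u u ((u , 1) ∷ []) []
single u = mkPath [] refl ↭-refl ↭-refl

join : ∀ {u v u′ v′ V V′ D D′} → Path u v V D → Path u′ v′ V′ D′ → ∀ d → Distance v u′ d →
  Path u v′ (V ++ V′) (D ++ (d , 1) ∷ D′)
join {u} {u′ = u′} {V = V} {V′} {D} {D′} (mkPath t refl vs ds) (mkPath t′ refl vs′ ds′) d dist =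
  mkPath (t ++ u′ ∷ t′) (endOf-++ u t u′ t′)
    (↭-trans (++⁺ vs vs′) (↭-reflexive (sym (⟦⟧-++ V V′))))
    (↭-trans (↭-reflexive (trans (steps-++ u t u′ t′) (cong (λ e → steps u t ++ e ∷ steps u′ t′) (distance dist))))
      (↭-trans (++⁺ ds (prep d ds′)) (↭-reflexive (sym (⟦⟧-++ D ((d , 1) ∷ D′))))))

reverse-tail : ∀ u t → ∃ λ t′ → endOf (endOf u t) t′ ≡ u × (endOf u t ∷ t′ ↭ u ∷ t) × (steps (endOf u t) t′ ↭ steps u t)
reverse-tail u []      = [] , refl , ↭-refl , ↭-refl
reverse-tail u (w ∷ t) with reverse-tail w t
... | t′ , e , vs , ds = t′ ++ [ u ] , endOf-++ z t′ u []
      , ↭-trans (++-comm (z ∷ t′) [ u ]) (prep u vs)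
      , ↭-trans (↭-reflexive (trans (steps-++ z t′ u []) (cong (λ x → steps z t′ ++ [ x ]) (trans (cong ∣_- u ∣ e) (∣-∣-comm w u)))))
          (↭-trans (++-comm (steps z t′) [ ∣ u - w ∣ ]) (prep _ ds))
  where z = endOf w t

rev : ∀ {u v V D} → Path u v V D → Path v u V D
rev {u} (mkPath t refl vs ds) = let t′ , e , vs′ , ds′ = reverse-tail u t in mkPath t′ e (↭-trans vs′ vs) (↭-trans ds′ ds)


-- Zigzags between two intervals of equal length

-- If `s + n + c ≡ t` and `suc ℓ ≡ 2 * n`, the possible distances between the two intervals are
-- exactly `suc c` to `c + ℓ`, one for each of the `ℓ` steps.
Block : (s t c n ℓ w : ℕ) → Set
Block s t c n ℓ w = Path (s + w) (t + w) ((s , n) ∷ (t , n) ∷ []) ((suc c , ℓ) ∷ [])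

-- If w < m, the walk first uses up the positions up to w of the lower interval together with the top of the
-- upper one, and then jumps into the block of the remaining positions; if w > m, it starts with the
-- positions from w on. In the middle, both halves are plain zigzags. The jumps use the distances left over
-- between the two sub-blocks. The argument f only bounds the recursion.
block′ : ∀ f s t c n ℓ w m → s + n + c ≡ t → suc (w + m) ≡ n → suc ℓ ≡ 2 * n → w + m < f → Block s t c n ℓ w
block′ (suc f) s _ c _ _ w m refl refl refl (s≤s b) with compare w m
... | less .w r = cast
        (join (block′ f s (t + n₁) d (suc w) (w + suc (w + 0)) w 0 (outer s c w r) (cong suc (+-identityʳ w)) refl
                 (≤-trans (s≤s (+-monoʳ-≤ w z≤n)) b′))
              (block′ f (s + suc w) t c n₁ ℓ₁ w r (inner s c w r) refl refl (≤-trans (s≤s (m≤n+m (w + r) w)) b′))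
              d (down (link s c w r)))
        refl refl
        (merge₂ (0 ∷ 1 ∷ 1 ∷ []) 2 (refl , refl , sum₁ s w r) (refl , refl , sum₂ t w r))
        (merge₁ (2 ∷ 1 ∷ []) (refl , refl , +-comm 1 d , sumD c w r))
  where
  n₁ = suc (w + r)
  ℓ₁ = w + r + suc (w + r + 0)
  t  = s + suc (w + suc (w + r)) + c
  d  = suc c + ℓ₁
  b′ : suc (w + (w + r)) ≤ f
  b′ = ≤-trans (≤-reflexive (sym (+-suc w _))) b
  outer : ∀ s c w r → s + suc w + (suc c + (w + r + suc (w + r + 0))) ≡ s + suc (w + suc (w + r)) + c + suc (w + r)
  outer = solve-∀
  inner : ∀ s c w r → s + suc w + suc (w + r) + c ≡ s + suc (w + suc (w + r)) + c
  inner = solve-∀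
  link : ∀ s c w r → s + suc w + w + (suc c + (w + r + suc (w + r + 0))) ≡ s + suc (w + suc (w + r)) + c + suc (w + r) + w
  link = solve-∀
  sum₁ : ∀ s w r → s + suc w + suc (w + r) ≡ s + suc (w + suc (w + r))
  sum₁ = solve-∀
  sum₂ : ∀ s w r → s + suc (w + r) + suc w ≡ s + suc (w + suc (w + r))
  sum₂ = solve-∀
  sumD : ∀ c w r → suc (suc c + (w + r + suc (w + r + 0))) + (w + suc (w + 0)) ≡ suc c + (w + suc (w + r) + suc (w + suc (w + r) + 0))
  sumD = solve-∀
block′ (suc f) s _ c _ _ zero .zero refl refl refl b | equal .zero =
  cast (join (single s) (single (s + 1 + c)) (suc c) (up (link s c)))
    (sym (+-identityʳ s)) (sym (+-identityʳ _))
    (merge₂ (0 ∷ []) 1 (refl , refl) (refl , refl)) (merge₁ [] (refl , refl))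
  where
  link : ∀ s c → s + suc c ≡ s + 1 + c
  link = solve-∀
block′ (suc f) s _ c _ _ (suc w) .(suc w) refl refl refl (s≤s b) | equal .(suc w) = cast
        (join (single (s + suc w))
          (join (rev (block′ f s (t + suc (suc w)) d₂ (suc w) (w + suc (w + 0)) 0 w (outer s c w) refl refl b₁))
            (join (single t)
              (block′ f (s + suc (suc w)) (suc t) (suc c) (suc w) (w + suc (w + 0)) w 0 (inner s c w) (cong suc (+-identityʳ w)) refl b₂)
              (suc c) (down (link₀ s c w)))
            d₁ (up (link₁ s c w)))
          d₂ (up (link₂ s c w)))
        refl (sym (+-suc t w))
        (merge₂ (1 ∷ 0 ∷ 2 ∷ 1 ∷ 1 ∷ []) 3
          (refl , refl , sum₀ s w , sum₁ s w)
          (refl , +-comm 1 t , sum₂ t w , sum₃ t w))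
        (merge₁ (3 ∷ 3 ∷ 2 ∷ []) (refl , +-comm 1 (suc c) , refl , refl , +-comm 1 d₂ , sumD c w))
  where
  t  = s + suc (suc w + suc w) + c
  d₁ = suc (suc c) + (w + suc (w + 0))
  d₂ = d₁ + 1
  b₁ : suc w ≤ f
  b₁ = ≤-trans (s≤s (m≤m+n w (suc w))) b
  b₂ : suc (w + 0) ≤ f
  b₂ = ≤-trans (≤-reflexive (cong suc (+-identityʳ w))) b₁
  outer : ∀ s c w → s + suc w + (suc (suc c) + (w + suc (w + 0)) + 1) ≡ s + suc (suc w + suc w) + c + suc (suc w)
  outer = solve-∀
  inner : ∀ s c w → s + suc (suc w) + suc w + suc c ≡ suc (s + suc (suc w + suc w) + c)
  inner = solve-∀
  link₀ : ∀ s c w → s + suc (suc w) + w + suc c ≡ s + suc (suc w + suc w) + c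
  link₀ = solve-∀
  link₁ : ∀ s c w → s + 0 + (suc (suc c) + (w + suc (w + 0))) ≡ s + suc (suc w + suc w) + c
  link₁ = solve-∀
  link₂ : ∀ s c w → s + suc w + (suc (suc c) + (w + suc (w + 0)) + 1) ≡ s + suc (suc w + suc w) + c + suc (suc w) + 0
  link₂ = solve-∀
  sum₀ : ∀ s w → s + suc (suc w) ≡ s + suc w + 1
  sum₀ = solve-∀
  sum₁ : ∀ s w → s + suc (suc w) + suc w ≡ s + suc (suc w + suc w)
  sum₁ = solve-∀
  sum₂ : ∀ t w → t + suc (suc w) ≡ suc t + suc w
  sum₂ = solve-∀
  sum₃ : ∀ t w → t + suc (suc w) + suc w ≡ t + suc (suc w + suc w)
  sum₃ = solve-∀
  sumD : ∀ c w → suc (suc (suc c) + (w + suc (w + 0)) + 1) + (w + suc (w + 0)) ≡ suc c + (suc w + suc w + suc (suc w + suc w + 0))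
  sumD = solve-∀
block′ (suc f) s _ c _ _ _ m refl refl refl (s≤s b) | greater .m r = cast
        (join (block′ f (s + w) t c (suc m) (m + suc (m + 0)) 0 m (inner s c m r) refl refl (≤-trans (s≤s (m≤n+m m (m + r))) b))
              (block′ f s (t + suc m) d w (m + r + suc (m + r + 0)) r m (outer s c m r) (cong suc (+-comm r m)) refl
                (≤-trans (s≤s (≤-trans (≤-reflexive (+-comm r m)) (m≤m+n (m + r) m))) b))
              d (down (link s c m r)))
        (+-identityʳ _) (sumE t m r)
        (merge₂ (2 ∷ 0 ∷ []) 2 (refl , refl , sum₁ s m r) (refl , refl , sum₂ t m r))
        (merge₁ (0 ∷ 0 ∷ []) (refl , refl , +-comm 1 d , sumD c m r))
  where
  w = suc (m + r)
  t = s + suc (w + m) + c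
  d = suc c + (m + suc (m + 0))
  inner : ∀ s c m r → s + suc (m + r) + suc m + c ≡ s + suc (suc (m + r) + m) + c
  inner = solve-∀
  outer : ∀ s c m r → s + suc (m + r) + (suc c + (m + suc (m + 0))) ≡ s + suc (suc (m + r) + m) + c + suc m
  outer = solve-∀
  link : ∀ s c m r → s + r + (suc c + (m + suc (m + 0))) ≡ s + suc (suc (m + r) + m) + c + 0
  link = solve-∀
  sumE : ∀ t m r → t + suc m + r ≡ t + suc (m + r)
  sumE = solve-∀
  sum₁ : ∀ s m r → s + suc (m + r) + suc m ≡ s + suc (suc (m + r) + m)
  sum₁ = solve-∀
  sum₂ : ∀ t m r → t + suc m + suc (m + r) ≡ t + suc (suc (m + r) + m)
  sum₂ = solve-∀
  sumD : ∀ c m r → suc (suc c + (m + suc (m + 0))) + (m + r + suc (m + r + 0)) ≡ suc c + (suc (m + r) + m + suc (suc (m + r) + m + 0))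
  sumD = solve-∀

block : ∀ s t c n ℓ w → s + n + c ≡ t → suc ℓ ≡ 2 * n → w < n → Block s t c n ℓ w
block s t c n ℓ w p q w<n = let m , r = m≤n⇒∃[o]m+o≡n w<n in block′ (suc (w + m)) s t c n ℓ w m p r q ≤-refl

-- Labellings and their enlargement

concatMap-↭ : ∀ {A B : Set} (f : A → List B) {xs ys} → xs ↭ ys → concatMap f xs ↭ concatMap f ys
concatMap-↭ f _↭_.refl           = ↭-refl
concatMap-↭ f (prep x p)         = ++⁺ˡ (f x) (concatMap-↭ f p)
concatMap-↭ f (swap x y p)       = ↭-trans (shifts (f x) (f y)) (++⁺ˡ (f y) (++⁺ˡ (f x) (concatMap-↭ f p)))
concatMap-↭ f (_↭_.trans p q)    = ↭-trans (concatMap-↭ f p) (concatMap-↭ f q)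

cycleSteps : List ℕ → List ℕ
cycleSteps []      = []
cycleSteps (v ∷ t) = steps v (t ++ [ v ])

target : ℕ → ℕ → List ℕ
target zero    ε = range 1 ε
target (suc _) ε = 1 ∷ 3 ∷ 3 ∷ range 4 (ε ∸ 3)

-- A `GL` with unsigned distances. The length of the path is left out, since the number of vertices
-- determines it (`edges-tail`).
record Labelling (L : List ℕ) (a ε x y : ℕ) : Set where
  field
    cycles    : List (List ℕ)
    cyclesLen : map length cycles ≡ L
    twoCycles : List (List ℕ)
    twoLen    : map length twoCycles ≡ replicate a 2
    tail      : List ℕ
    end       : endOf x tail ≡ y
    vertices  : concat cycles ++ concat twoCycles ++ x ∷ tail ↭ range 0 (suc ε)
    distances : concatMap cycleSteps cycles ++ concatMap cycleSteps twoCycles ++ steps x tail ↭ target a ε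

range-≤ : ∀ s n → All (_≤ s + n) (range s (suc n))
range-≤ s zero    = m≤m+n s 0 ∷ []
range-≤ s (suc n) = m≤m+n s (suc n) ∷ All.map (λ p → ≤-trans p (≤-reflexive (sym (+-suc s n)))) (range-≤ (suc s) n)

-- Restricted to labels up to `ε` so as to cover the reflection `ε ∸_`, which is truncated beyond.
Isometry : ℕ → (ℕ → ℕ) → Set
Isometry ε f = ∀ {u w} → u ≤ ε → w ≤ ε → ∣ f u - f w ∣ ≡ ∣ u - w ∣

module _ {ε f} (iso : Isometry ε f) where

  steps-map : ∀ {u t} → u ≤ ε → All (_≤ ε) t → steps (f u) (map f t) ≡ steps u t
  steps-map b []       = refl
  steps-map b (b′ ∷ a) = cong₂ _∷_ (iso b b′) (steps-map b′ a)

  cycleSteps-map : ∀ {c} → All (_≤ ε) c → cycleSteps (map f c) ≡ cycleSteps c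
  cycleSteps-map []               = refl
  cycleSteps-map {v ∷ t} (b ∷ a) =
    trans (cong (steps (f v)) (sym (map-++ f t [ v ]))) (steps-map b (All.++⁺ a (b ∷ [])))

  concatMap-cycleSteps-map : ∀ cs → All (_≤ ε) (concat cs) → concatMap cycleSteps (map (map f) cs) ≡ concatMap cycleSteps cs
  concatMap-cycleSteps-map []       a = refl
  concatMap-cycleSteps-map (c ∷ cs) a = cong₂ _++_ (cycleSteps-map (All.++⁻ˡ c a)) (concatMap-cycleSteps-map cs (All.++⁻ʳ c a))

endOf-map : ∀ f u t → endOf (f u) (map f t) ≡ f (endOf u t)
endOf-map f u []      = refl
endOf-map f u (w ∷ t) = endOf-map f w t

map-length-map : ∀ (f : ℕ → ℕ) cs → map length (map (map f) cs) ≡ map length cs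
map-length-map f []       = refl
map-length-map f (c ∷ cs) = cong₂ _∷_ (length-map f c) (map-length-map f cs)

-- By `3 ≤ ε` the subtraction `ε ∸ 3` is exact, so the old distances stop at `ε`, where the new ones
-- continue.
target-+ : ∀ a ε n → 3 ≤ ε → range (suc ε) n ++ target a ε ↭ target a (ε + n)
target-+ zero    ε n _ = ↭-trans (++-comm (range (suc ε) n) (range 1 ε)) (↭-reflexive (range-++ 1 ε n))
target-+ (suc _) (suc (suc (suc ε))) n (s≤s (s≤s (s≤s _))) =
  ↭-trans (++-comm (range (4 + ε) n) (1 ∷ 3 ∷ 3 ∷ range 4 ε)) (↭-reflexive (cong (λ r → 1 ∷ 3 ∷ 3 ∷ r) (range-++ 4 ε n)))

gather : ∀ (A B C P Q : List ℕ) → (A ++ B) ++ C ++ P ++ Q ↭ (A ++ P) ++ B ++ C ++ Q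
gather A B C P Q = ↭-trans (↭-reflexive (++-assoc A B _))
  (↭-trans (++⁺ˡ A (↭-trans (++⁺ˡ B (shifts C P)) (shifts B P))) (↭-reflexive (sym (++-assoc A P _))))

record Cycles (L : List ℕ) (V D : Intervals) : Set where
  field
    cycles    : List (List ℕ)
    cyclesLen : map length cycles ≡ L
    vertices  : concat cycles ↭ ⟦ V ⟧
    distances : concatMap cycleSteps cycles ↭ ⟦ D ⟧

-- Shifting the old labels by `p` keeps their distances. The new walk is put in front of the old
-- path and enters it at `p + x`, so `u` becomes the new first end.
surround : ∀ {L L′ a ε x y} → Labelling L a ε x y → 3 ≤ ε →
  ∀ {n u v V D V′ D′ d} p → Cycles L′ V′ D′ → Path u v V D → Distance v (p + x) d →
  (V′ ++ V ++ (p , suc ε) ∷ []) ≈ ((0 , suc (ε + n)) ∷ []) → (D′ ++ D ++ (d , 1) ∷ []) ≈ ((suc ε , n) ∷ []) →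
  Labelling (L′ ++ L) a (ε + n) u (p + y)
surround {L} {L′} {a} {ε} {x} {y} G 3≤ε {n} {u} {v} {V} {D} {V′} {D′} {d} p C (mkPath t refl pv pd) dist (same vs) (same ds) = record
  { cycles    = cs ++ map (map f) cycles
  ; cyclesLen = trans (map-++ length cs (map (map f) cycles)) (cong₂ _++_ (Cycles.cyclesLen C) (trans (map-length-map f cycles) cyclesLen))
  ; twoCycles = map (map f) twoCycles
  ; twoLen    = trans (map-length-map f twoCycles) twoLen
  ; tail      = t ++ f x ∷ map f tail
  ; end       = trans (endOf-++ u t (f x) (map f tail)) (trans (endOf-map f x tail) (cong f end))
  ; vertices  = ↭-trans (↭-reflexive (cong₂ _++_ (trans (sym (concat-++ cs (map (map f) cycles))) (cong (concat cs ++_) (concat-map cycles)))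
                                       (cong (_++ ((u ∷ t) ++ map f (x ∷ tail))) (concat-map twoCycles))))
                (↭-trans (gather (concat cs) (map f (concat cycles)) (map f (concat twoCycles)) (u ∷ t) (map f (x ∷ tail)))
                (↭-trans (++⁺ (++⁺ cv pv)
                   (↭-trans (↭-reflexive (sym (trans (map-++ f (concat cycles) _) (cong (map f (concat cycles) ++_) (map-++ f (concat twoCycles) _)))))
                     (↭-trans (map⁺ f vertices) (↭-reflexive (trans (map-+-range p 0 (suc ε)) (cong (λ s → range s (suc ε)) (+-identityʳ p)))))))
                (↭-trans (↭-reflexive (unfold V′ V p (suc ε))) (↭-trans vs (↭-reflexive (++-identityʳ _))))))
  ; distances = ↭-trans (↭-reflexive (cong₂ _++_
                    (trans (cong concat (map-++ cycleSteps cs (map (map f) cycles)))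
                      (trans (sym (concat-++ (map cycleSteps cs) (map cycleSteps (map (map f) cycles))))
                        (cong (concatMap cycleSteps cs ++_) (concatMap-cycleSteps-map iso cycles (All.++⁻ˡ (concat cycles) bounds)))))
                    (cong₂ _++_ (concatMap-cycleSteps-map iso twoCycles (All.++⁻ˡ (concat twoCycles) bounds′))
                      (trans (steps-++ u t (f x) (map f tail))
                        (trans (cong₂ (λ e r → steps u t ++ e ∷ r) (distance dist) (steps-map iso (All.head bounds″) (All.tail bounds″)))
                          (sym (++-assoc (steps u t) [ d ] (steps x tail))))))))
                (↭-trans (gather (concatMap cycleSteps cs) (concatMap cycleSteps cycles) (concatMap cycleSteps twoCycles) (steps u t ++ [ d ]) (steps x tail))
                (↭-trans (++⁺ (↭-trans (++⁺ cd (++⁺ʳ [ d ] pd)) (↭-trans (↭-reflexive (unfold′ D′ D d)) (↭-trans ds (↭-reflexive (++-identityʳ _))))) distances)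
                (target-+ a ε n 3≤ε)))
  }
  where
  open Labelling G
  open Cycles C using () renaming (cycles to cs; vertices to cv; distances to cd)
  f = p +_
  iso : Isometry ε f
  iso _ _ = ∣m+n-m+o∣≡∣n-o∣ p _ _
  bounds = All-resp-↭ (↭-sym vertices) (range-≤ 0 ε)
  bounds′ = All.++⁻ʳ (concat cycles) bounds
  bounds″ = All.++⁻ʳ (concat twoCycles) bounds′
  unfold : ∀ I J s m → (⟦ I ⟧ ++ ⟦ J ⟧) ++ range s m ≡ ⟦ I ++ J ++ (s , m) ∷ [] ⟧
  unfold I J s m = trans (++-assoc ⟦ I ⟧ ⟦ J ⟧ (range s m)) (sym (trans (⟦⟧-++ I (J ++ (s , m) ∷ []))
    (cong (⟦ I ⟧ ++_) (trans (⟦⟧-++ J ((s , m) ∷ [])) (cong (⟦ J ⟧ ++_) (++-identityʳ (range s m)))))))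
  unfold′ : ∀ I J e → ⟦ I ⟧ ++ ⟦ J ⟧ ++ [ e ] ≡ ⟦ I ++ J ++ (e , 1) ∷ [] ⟧
  unfold′ I J e = sym (trans (⟦⟧-++ I (J ++ (e , 1) ∷ [])) (cong (⟦ I ⟧ ++_) (⟦⟧-++ J ((e , 1) ∷ []))))

-- Reflection of labels and reordering of cycles

module Complement (ε : ℕ) where

  dist-≤ : ∀ {u w} → u ≤ w → w ≤ ε → ∣ ε ∸ u - ε ∸ w ∣ ≡ ∣ u - w ∣
  dist-≤ {u} {w} u≤w w≤ε = trans (m≤n⇒∣n-m∣≡n∸m (∸-monoʳ-≤ ε u≤w)) (trans cancel (sym (m≤n⇒∣m-n∣≡n∸m u≤w)))
    where
    cancel : (ε ∸ u) ∸ (ε ∸ w) ≡ w ∸ u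
    cancel = trans (∸-+-assoc ε u (ε ∸ w)) (trans (cong (ε ∸_) (+-comm u (ε ∸ w)))
      (trans (sym (∸-+-assoc ε (ε ∸ w) u)) (cong (_∸ u) (m∸[m∸n]≡n w≤ε))))

  isometry : Isometry ε (ε ∸_)
  isometry {u} {w} u≤ε w≤ε with ≤-total u w
  ... | inj₁ u≤w = dist-≤ u≤w w≤ε
  ... | inj₂ w≤u = trans (∣-∣-comm (ε ∸ u) (ε ∸ w)) (trans (dist-≤ w≤u u≤ε) (∣-∣-comm w u))

map-∸-range : ∀ s n → map (s + n ∸_) (range s (suc n)) ↭ range 0 (suc n)
map-∸-range s zero    = ↭-reflexive (cong [_] (m+n∸m≡n s 0))
map-∸-range s (suc n) rewrite m+n∸m≡n s (suc n) | +-suc s n =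
  ↭-trans (prep (suc n) (map-∸-range (suc s) n))
    (↭-trans (++-comm [ suc n ] (range 0 (suc n))) (↭-reflexive (trans (range-++ 0 (suc n) 1) (cong (range 0) (+-comm (suc n) 1)))))

complement : ∀ {L a ε x y} → Labelling L a ε x y → Labelling L a ε (ε ∸ x) (ε ∸ y)
complement {ε = ε} {x} G = record
  { cycles    = map (map f) cycles
  ; cyclesLen = trans (map-length-map f cycles) cyclesLen
  ; twoCycles = map (map f) twoCycles
  ; twoLen    = trans (map-length-map f twoCycles) twoLen
  ; tail      = map f tail
  ; end       = trans (endOf-map f x tail) (cong f end)
  ; vertices  = ↭-trans (↭-reflexive (trans (cong₂ (λ A B → A ++ B ++ map f (x ∷ tail)) (concat-map cycles) (concat-map twoCycles))
                  (sym (trans (map-++ f (concat cycles) _) (cong (map f (concat cycles) ++_) (map-++ f (concat twoCycles) _))))))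
                  (↭-trans (map⁺ f vertices) (map-∸-range 0 ε))
  ; distances = ↭-trans (↭-reflexive (cong₂ _++_ (concatMap-cycleSteps-map isometry cycles (All.++⁻ˡ (concat cycles) bounds))
                  (cong₂ _++_ (concatMap-cycleSteps-map isometry twoCycles (All.++⁻ˡ (concat twoCycles) bounds′))
                    (steps-map isometry (All.head bounds″) (All.tail bounds″))))) distances
  }
  where
  open Labelling G
  open Complement ε
  f = ε ∸_
  bounds = All-resp-↭ (↭-sym vertices) (range-≤ 0 ε)
  bounds′ = All.++⁻ʳ (concat cycles) bounds
  bounds″ = All.++⁻ʳ (concat twoCycles) bounds′

endOf-All : ∀ {P : ℕ → Set} {u t} → P u → All P t → P (endOf u t)
endOf-All p []      = p
endOf-All p (q ∷ a) = endOf-All q a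

end-≤ : ∀ {L a ε x y} → Labelling L a ε x y → y ≤ ε
end-≤ {ε = ε} G = subst (_≤ ε) end (endOf-All (All.head bounds) (All.tail bounds))
  where
  open Labelling G
  bounds = All.++⁻ʳ (concat twoCycles) (All.++⁻ʳ (concat cycles) (All-resp-↭ (↭-sym vertices) (range-≤ 0 ε)))

-- Needed because the longest cycle is added first, wherever it stands in `L`.
permute : ∀ {L L′ a ε x y} → L ↭ L′ → Labelling L a ε x y → Labelling L′ a ε x y
permute {ε = ε} {x} p G with ↭-map-inv length (↭-trans (↭-reflexive (Labelling.cyclesLen G)) p)
... | cycles′ , len , q = record
  { cycles    = cycles′
  ; cyclesLen = sym len
  ; twoCycles = twoCycles
  ; twoLen    = twoLen
  ; tail      = tail
  ; end       = end
  ; vertices  = ↭-trans (++⁺ʳ _ concat-↭) vertices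
  ; distances = ↭-trans (++⁺ʳ _ (concatMap-↭ cycleSteps (↭-sym q))) distances
  }
  where
  open Labelling G
  concat-↭ : concat cycles′ ↭ concat cycles
  concat-↭ = ↭-trans (↭-reflexive (cong concat (sym (map-id cycles′)))) (↭-trans (concatMap-↭ (λ c → c) (↭-sym q)) (↭-reflexive (cong concat (map-id cycles))))

-- From unsigned distances to signed differences

diffs-pm : ∀ u w → diff u w ∷ diff w u ∷ [] ↭ pm ∣ u - w ∣
diffs-pm u w with ≤-total w u
... | inj₁ w≤u rewrite ℤ.m-n≡m⊖n u w | ℤ.m-n≡m⊖n w u | ℤ.⊖-≥ w≤u | ℤ.⊖-≤ w≤u | m≤n⇒∣n-m∣≡n∸m w≤u = ↭-refl
... | inj₂ u≤w rewrite ℤ.m-n≡m⊖n u w | ℤ.m-n≡m⊖n w u | ℤ.⊖-≥ u≤w | ℤ.⊖-≤ u≤w | m≤n⇒∣m-n∣≡n∸m u≤w = swap _ _ ↭-refl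

pathΔ-steps : ∀ u t → pathΔ (u ∷ t) ↭ concatMap pm (steps u t)
pathΔ-steps u []      = ↭-refl
pathΔ-steps u (w ∷ t) = ++⁺ (diffs-pm u w) (pathΔ-steps w t)

cycleΔ-steps : ∀ c → cycleΔ c ↭ concatMap pm (cycleSteps c)
cycleΔ-steps []      = ↭-refl
cycleΔ-steps (v ∷ t) = pathΔ-steps v (t ++ [ v ])

concatMap-cycleΔ : ∀ cs → concatMap cycleΔ cs ↭ concatMap pm (concatMap cycleSteps cs)
concatMap-cycleΔ []       = ↭-refl
concatMap-cycleΔ (c ∷ cs) = ↭-trans (++⁺ (cycleΔ-steps c) (concatMap-cycleΔ cs)) (↭-reflexive (sym (concatMap-++ pm (cycleSteps c) (concatMap cycleSteps cs))))

applyUpTo-range : ∀ f s n → (∀ i → f i ≡ s + i) → applyUpTo f n ≡ range s n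
applyUpTo-range f s zero    p = refl
applyUpTo-range f s (suc n) p = cong₂ _∷_ (trans (p 0) (+-identityʳ s)) (applyUpTo-range (λ i → f (suc i)) (suc s) n (λ i → trans (p (suc i)) (+-suc s i)))

upTo-range : ∀ n → upTo n ≡ range 0 n
upTo-range n = applyUpTo-range (λ i → i) 0 n (λ _ → refl)

concatMap-pm-range : ∀ s n → concatMap pm (range s n) ≡ concatMap (λ i → pm (s + i)) (upTo n)
concatMap-pm-range s n = cong concat (trans (cong (map pm) (trans (cong (λ r → range r n) (sym (+-identityʳ s)))
  (trans (sym (map-+-range s 0 n)) (cong (map (s +_)) (sym (upTo-range n)))))) (sym (map-∘ (upTo n))))

targetΔ-target : ∀ a ε → concatMap pm (target a ε) ≡ targetΔ a ε
targetΔ-target zero    ε = concatMap-pm-range 1 ε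
targetΔ-target (suc _) ε = cong (λ r → pm 1 ++ pm 3 ++ pm 3 ++ r) (concatMap-pm-range 4 (ε ∸ 3))

length-concat : ∀ (cs : List (List ℕ)) → length (concat cs) ≡ sum (map length cs)
length-concat []       = refl
length-concat (c ∷ cs) = trans (length-++ c) (cong (length c +_) (length-concat cs))

sum-replicate : ∀ a → sum (replicate a 2) ≡ 2 * a
sum-replicate zero    = refl
sum-replicate (suc a) = trans (cong (2 +_) (sum-replicate a)) (sym (*-suc 2 a))

last-endOf : ∀ u t → last (u ∷ t) ≡ just (endOf u t)
last-endOf u []      = refl
last-endOf u (w ∷ t) = last-endOf w t

module _ {L a ε x y} (G : Labelling L a ε x y) where
  open Labelling G

  -- Count vertices: `sum L` on the cycles, `2 * a` on the 2-cycles and `suc (length tail)` on the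
  -- path make up all `suc ε` labels.
  edges-tail : edges L a (length tail) ≡ ε
  edges-tail = suc-injective (trans (sym (+-suc (sum L + 2 * a) (length tail))) (trans
    (trans (+-assoc (sum L) (2 * a) _) (cong₂ _+_ (sym (trans (length-concat cycles) (cong sum cyclesLen)))
      (cong (_+ length (x ∷ tail)) (sym (trans (length-concat twoCycles) (trans (cong sum twoLen) (sum-replicate a)))))))
    (trans (sym (trans (length-++ (concat cycles)) (cong (length (concat cycles) +_) (length-++ (concat twoCycles)))))
      (trans (↭-length vertices) (length-range 0 (suc ε))))))

  pathEdges : length tail ≡ ε ∸ sum L ∸ 2 * a
  pathEdges = sym (trans (∸-+-assoc ε (sum L) (2 * a)) (trans (cong (_∸ (sum L + 2 * a)) (sym edges-tail)) (m+n∸m≡n (sum L + 2 * a) (length tail))))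

  path-nonempty : x < y → sum L + 2 * a + 1 ≤ ε
  path-nonempty x<y = ≤-trans (+-monoʳ-≤ (sum L + 2 * a) (nonempty tail end)) (≤-reflexive edges-tail)
    where
    nonempty : ∀ t → endOf x t ≡ y → 1 ≤ length t
    nonempty []      p = contradiction (subst (_< y) p x<y) (n≮n y)
    nonempty (_ ∷ _) _ = s≤s z≤n

  toGL : GL L a (ε ∸ sum L ∸ 2 * a) x y
  toGL = subst (λ m → GL L a m x y) pathEdges (record
    { cycles    = cycles
    ; cyclesLen = cyclesLen
    ; twoCycles = twoCycles
    ; twoLen    = twoLen
    ; path      = x ∷ tail
    ; pathLen   = refl
    ; pathStart = refl
    ; pathEnd   = trans (last-endOf x tail) (cong just end)
    ; vertexSet = ↭-trans vertices (↭-reflexive (trans (sym (upTo-range (suc ε))) (cong (λ n → upTo (suc n)) (sym edges-tail))))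
    ; diffs     = ↭-trans (++⁺ (concatMap-cycleΔ cycles) (++⁺ (concatMap-cycleΔ twoCycles) (pathΔ-steps x tail)))
                    (↭-trans (↭-reflexive (sym (trans (concatMap-++ pm (concatMap cycleSteps cycles) _)
                        (cong (concatMap pm (concatMap cycleSteps cycles) ++_) (concatMap-++ pm (concatMap cycleSteps twoCycles) _)))))
                      (↭-trans (concatMap-↭ pm distances) (↭-reflexive (trans (targetΔ-target a ε) (cong (targetΔ a) (sym edges-tail))))))
    })

-- Zigzags on one interval, closing a cycle, lengthening the path

-- Jump from one end to the other by the longest distance and continue on the rest. The final
-- position depends on the parity of `n`, hence the existential.
zigzag-up : ∀ s n → ∃ λ y → Path s (s + y) ((s , suc n) ∷ []) ((1 , n) ∷ [])
zigzag-down : ∀ s n → ∃ λ y → Path (s + n) (s + y) ((s , suc n) ∷ []) ((1 , n) ∷ [])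

zigzag-up s zero    = 0 , cast (single s) refl (sym (+-identityʳ s)) (same ↭-refl) (same ↭-refl)
zigzag-up s (suc n) = let y , P = zigzag-down (suc s) n in
  suc y , cast (join (single s) P (suc n) (up (+-suc s n))) refl (sym (+-suc s y))
    (merge₁ [] (refl , +-comm 1 s , sym (+-suc s (suc n)))) (merge₁ (1 ∷ []) (refl , refl , +-comm (suc n) 1))

zigzag-down s zero    = 0 , cast (single s) (sym (+-identityʳ s)) (sym (+-identityʳ s)) (same ↭-refl) (same ↭-refl)
zigzag-down s (suc n) = let y , P = zigzag-up s n in
  y , cast (join (single (s + suc n)) P (suc n) (down refl)) refl refl
    (merge₁ (1 ∷ []) (refl , refl , trans (+-assoc s (suc n) 1) (cong (s +_) (+-comm (suc n) 1))))
    (merge₁ (1 ∷ []) (refl , refl , +-comm (suc n) 1))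

size : Intervals → ℕ
size []            = 0
size ((_ , n) ∷ I) = n + size I

length-⟦⟧ : ∀ I → length ⟦ I ⟧ ≡ size I
length-⟦⟧ []            = refl
length-⟦⟧ ((s , n) ∷ I) = trans (length-++ (range s n)) (cong₂ _+_ (length-range s n) (length-⟦⟧ I))

close : ∀ {u v V D} → Path u v V D → ∀ {ℓ} → size V ≡ ℓ → ∀ d → Distance v u d → Cycles (ℓ ∷ []) V (D ++ (d , 1) ∷ [])
close {u} {V = V} {D} (mkPath t refl vs ds) len d dist = record
  { cycles    = (u ∷ t) ∷ []
  ; cyclesLen = cong [_] (trans (↭-length vs) (trans (length-⟦⟧ V) len))
  ; vertices  = ↭-trans (↭-reflexive (++-identityʳ (u ∷ t))) vs
  ; distances = ↭-trans (↭-reflexive (trans (++-identityʳ _) (trans (steps-++ u t u []) (cong (λ e → steps u t ++ [ e ]) (distance dist)))))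
                  (↭-trans (++⁺ʳ [ d ] ds) (↭-reflexive (sym (⟦⟧-++ D ((d , 1) ∷ [])))))
  }

noCycles : Cycles [] [] []
noCycles = record { cycles = [] ; cyclesLen = refl ; vertices = ↭-refl ; distances = ↭-refl }

-- A block around the old labels, started at offset `x`, ends `suc ε` above the shifted old end, so
-- the first end of the path is again `x`.
extend : ∀ {L a ε x y} → Labelling L a ε x y → 3 ≤ ε → ∀ h → x < suc h → Labelling L a (ε + 2 * suc h) x (suc h + y)
extend {ε = ε} {x} G 3≤ε h x<h = surround G 3≤ε (suc h) noCycles
  (block 0 (suc h + suc ε) (suc ε) (suc h) (h + suc (h + 0)) x refl refl x<h)
  (down (link ε h x))
  (merge₁ (0 ∷ 1 ∷ []) (refl , refl , refl , sumV ε h))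
  (merge₁ (1 ∷ []) (refl , +-comm 1 (suc ε) , sumD ε h))
  where
  link : ∀ ε h x → suc h + x + suc ε ≡ suc h + suc ε + x
  link = solve-∀
  sumV : ∀ ε h → suc h + suc ε + suc h ≡ suc (ε + 2 * suc h)
  sumV = solve-∀
  sumD : ∀ ε h → suc (suc ε) + (h + suc (h + 0)) ≡ suc ε + 2 * suc h
  sumD = solve-∀

-- Adding one odd cycle

-- The lower intervals, from the bottom up, are X₁ = [0, a), the single vertex a, X₂ (from s₂), X₃ (from s₃)
-- and Y (from s₄); then come the old labels (from p) and the partners of Y, X₃, X₂, X₁ (from t₄, t₃, t₂, t₁).
-- The cycle is the zigzag on Y together with a; the path runs through X₂, X₁ and X₃ into the old path.
-- The numbers eᵢ are the distances not used inside the blocks: e₀ leads into the old path, e₂ and e₄ join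
-- a to the ends of Y, and e₇ and e₈ join X₁ to X₃ and X₂.
module Step (ε κ δ η : ℕ) (hyp : ε + suc κ + 1 ≡ 2 * suc η) (δ≤η : δ < suc η) where

  k = suc κ
  h = suc η
  α = suc (η + δ)
  a = suc α
  ℓ : ℕ → ℕ
  ℓ n = n + suc (n + 0)

  s₂ = a + 1
  s₃ = s₂ + h
  s₄ = s₃ + h
  p  = s₄ + k
  t₄ = p + suc ε
  t₃ = t₄ + k

  e₀ = suc ε
  e₂ = suc e₀ + ℓ κ
  e₄ = suc e₂ + ℓ η

  cycle : Cycles (2 * k + 1 ∷ []) ((a , 1) ∷ (s₄ , k) ∷ (t₄ , k) ∷ []) ((e₄ , 1) ∷ (suc e₀ , ℓ κ) ∷ (e₂ , 1) ∷ [])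
  cycle = close (join (single a) (rev (block s₄ t₄ e₀ k (ℓ κ) κ refl refl ≤-refl)) e₄ (up (link ε κ η a)))
    -- The edge inside the lower interval, from `s₄ + κ` to `a`, has length 2h + k. It has to be the
    -- first distance beyond the inner zigzag, ε + 2k + 1; this is `hyp`.
    (total κ) e₂ (down (trans (closing₁ ε κ a) (trans (cong (a + 1 + κ +_) hyp) (closing₂ κ η a))))
    where
    link : ∀ ε κ η a → a + (suc (suc (suc ε) + (κ + suc (κ + 0))) + (η + suc (η + 0))) ≡ a + 1 + suc η + suc η + suc κ + suc ε + κ
    link = solve-∀
    total : ∀ κ → 1 + (suc κ + (suc κ + 0)) ≡ 2 * suc κ + 1
    total = solve-∀
    closing₁ : ∀ ε κ a → a + (suc (suc ε) + (κ + suc (κ + 0))) ≡ a + 1 + κ + (ε + suc κ + 1)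
    closing₁ = solve-∀
    closing₂ : ∀ κ η a → a + 1 + κ + 2 * suc η ≡ a + 1 + suc η + suc η + κ
    closing₂ = solve-∀

  -- The case v = 1 leaves room for one more vertex, which changes the parity of the number of edges.
  module Outer (v : ℕ) where

    t₂ = t₃ + h + v
    t₁ = t₂ + h

    e₇ = suc (e₄ + v) + ℓ η
    e₈ = e₇ + 1

    path : Path (s₂ + η) (t₃ + δ) ((s₂ , h) ∷ (t₂ , h) ∷ (0 , a) ∷ (t₁ , a) ∷ (s₃ , h) ∷ (t₃ , h) ∷ [])
      ((suc (e₄ + v) , ℓ η) ∷ (e₈ , 1) ∷ (suc e₈ , ℓ α) ∷ (e₇ , 1) ∷ (suc e₂ , ℓ η) ∷ [])
    -- Offset `δ` in X₃ makes the walk end `e₀` above the shifted old end. Then `link₇` forces X₁ to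
    -- be entered at α = h + δ, and `link₈` forces `α` to be the top of X₁.
    path = join (block s₂ t₂ (e₄ + v) h (ℓ η) η (offset₂ ε κ η a v) refl ≤-refl)
      (join (block 0 t₁ e₈ a (ℓ α) α (offset₁ ε κ η a v) refl ≤-refl)
        (block s₃ t₃ e₂ h (ℓ η) δ (offset₃ ε κ η a) refl δ≤η)
        e₇ (down (link₇ ε κ η δ v)))
      e₈ (down (link₈ ε κ η δ v))
      where
      offset₃ : ∀ ε κ η a → a + 1 + suc η + suc η + (suc (suc ε) + (κ + suc (κ + 0))) ≡ a + 1 + suc η + suc η + suc κ + suc ε + suc κ
      offset₃ = solve-∀
      offset₂ : ∀ ε κ η a v → a + 1 + suc η + (suc (suc (suc ε) + (κ + suc (κ + 0))) + (η + suc (η + 0)) + v)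
        ≡ a + 1 + suc η + suc η + suc κ + suc ε + suc κ + suc η + v
      offset₂ = solve-∀
      offset₁ : ∀ ε κ η a v → a + (suc (suc (suc (suc ε) + (κ + suc (κ + 0))) + (η + suc (η + 0)) + v) + (η + suc (η + 0)) + 1)
        ≡ a + 1 + suc η + suc η + suc κ + suc ε + suc κ + suc η + v + suc η
      offset₁ = solve-∀
      link₇ : ∀ ε κ η δ v → suc (suc (η + δ)) + 1 + suc η + δ + (suc (suc (suc (suc ε) + (κ + suc (κ + 0))) + (η + suc (η + 0)) + v) + (η + suc (η + 0)))
        ≡ suc (suc (η + δ)) + 1 + suc η + suc η + suc κ + suc ε + suc κ + suc η + v + suc η + suc (η + δ)
      link₇ = solve-∀
      link₈ : ∀ ε κ η δ v → suc (η + δ) + (suc (suc (suc (suc ε) + (κ + suc (κ + 0))) + (η + suc (η + 0)) + v) + (η + suc (η + 0)) + 1)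
        ≡ suc (suc (η + δ)) + 1 + suc η + suc η + suc κ + suc ε + suc κ + suc η + v + η
      link₈ = solve-∀

  -- The number of new vertices: 2k + 1 on the cycle and 2(2h + a) on the path.
  size₀ : ℕ
  size₀ = 2 * κ + 6 * η + 2 * δ + 11

  join-inner : t₃ + δ ≡ p + (k + δ) + suc ε
  join-inner = eq p ε k δ
    where
    eq : ∀ p ε k δ → p + suc ε + k + δ ≡ p + (k + δ) + suc ε
    eq = solve-∀

  step₀ : ∀ {L b y} → 3 ≤ ε → Labelling L b ε (k + δ) y → Labelling (2 * k + 1 ∷ L) b (ε + size₀) (s₂ + η) (p + y)
  step₀ 3≤ε G =
    surround G 3≤ε p cycle path (down (sym join-inner))
      (merge₁ (5 ∷ 0 ∷ 2 ∷ 4 ∷ 0 ∷ 4 ∷ 0 ∷ 2 ∷ [])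
        (refl , refl , refl , refl , refl , refl , refl , refl , +-identityʳ (t₃ + h) , refl , sumV ε κ η δ))
      (merge₁ (8 ∷ 1 ∷ 1 ∷ 5 ∷ 0 ∷ 0 ∷ 2 ∷ [])
        (refl , +-comm 1 e₀ , refl , +-comm 1 e₂ , refl , trans (cong suc (+-identityʳ e₄)) (+-comm 1 e₄) , refl , refl , +-comm 1 e₈ , sumD ε κ η δ))
    where
    open Outer 0
    sumV : ∀ ε κ η δ → suc (suc (η + δ)) + 1 + suc η + suc η + suc κ + suc ε + suc κ + suc η + 0 + suc η + suc (suc (η + δ))
      ≡ suc (ε + (2 * κ + 6 * η + 2 * δ + 11))
    sumV = solve-∀
    sumD : ∀ ε κ η δ → suc (suc (suc (suc (suc ε) + (κ + suc (κ + 0))) + (η + suc (η + 0)) + 0) + (η + suc (η + 0)) + 1) + (suc (η + δ) + suc (suc (η + δ) + 0))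
      ≡ suc ε + (2 * κ + 6 * η + 2 * δ + 11)
    sumD = solve-∀

  step₁ : ∀ {L b y} → 3 ≤ ε → Labelling L b ε (k + δ) y → Labelling (2 * k + 1 ∷ L) b (ε + suc size₀) (t₃ + h) (p + y)
  step₁ 3≤ε G =
    surround G 3≤ε p cycle
      -- The extra vertex fills the gap below `t₂`, and the skipped distance `e₄ + 1` attaches it to
      -- the start of `path`.
      (join (single (t₃ + h)) path (e₄ + 1) (down (link ε κ η a)))
      (down (sym join-inner))
      (merge₁ (6 ∷ 0 ∷ 3 ∷ 5 ∷ 0 ∷ 5 ∷ 0 ∷ 3 ∷ [])
        (refl , refl , refl , refl , refl , refl , refl , refl , refl , refl , refl , sumV ε κ η δ))
      (merge₁ (9 ∷ 1 ∷ 1 ∷ 6 ∷ 0 ∷ 0 ∷ 0 ∷ 2 ∷ [])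
        (refl , +-comm 1 e₀ , refl , +-comm 1 e₂ , refl , refl , +-comm 1 (e₄ + 1) , refl , refl , +-comm 1 e₈ , sumD ε κ η δ))
    where
    open Outer 1
    link : ∀ ε κ η a → a + 1 + η + (suc (suc (suc ε) + (κ + suc (κ + 0))) + (η + suc (η + 0)) + 1)
      ≡ a + 1 + suc η + suc η + suc κ + suc ε + suc κ + suc η
    link = solve-∀
    sumV : ∀ ε κ η δ → suc (suc (η + δ)) + 1 + suc η + suc η + suc κ + suc ε + suc κ + suc η + 1 + suc η + suc (suc (η + δ))
      ≡ suc (ε + suc (2 * κ + 6 * η + 2 * δ + 11))
    sumV = solve-∀
    sumD : ∀ ε κ η δ → suc (suc (suc (suc (suc ε) + (κ + suc (κ + 0))) + (η + suc (η + 0)) + 1) + (η + suc (η + 0)) + 1) + (suc (η + δ) + suc (suc (η + δ) + 0))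
      ≡ suc ε + suc (2 * κ + 6 * η + 2 * δ + 11)
    sumD = solve-∀

-- Parity and the inductive step

even⊎odd : ∀ n → ∃ λ h → n ≡ 2 * h ⊎ n ≡ suc (2 * h)
even⊎odd zero    = 0 , inj₁ refl
even⊎odd (suc n) with even⊎odd n
... | h , inj₁ p = h , inj₂ (cong suc p)
... | h , inj₂ p = suc h , inj₁ (trans (cong (λ m → suc m) p) (sym (*-suc 2 h)))

-- The parity of ε is the one needed for adding a cycle of length 2 k + 1 to the labelling.
record State (L : List ℕ) (b K k M : ℕ) : Set where
  field
    {ε x y h} : ℕ
    labelling : Labelling L b ε x y
    3≤ε       : 3 ≤ ε
    K≤x       : K ≤ x
    2x<ε      : 2 * x < ε
    x<y       : x < y
    parity    : ε + k + 1 ≡ 2 * h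
    bound     : suc ε ≤ M

module _ {ε : ℕ} (κ δ η : ℕ) (hyp : ε + suc κ + 1 ≡ 2 * suc η) (δ<h : δ < suc η) where

  open Step ε κ δ η hyp δ<h using (size₀; p; s₂; t₃; step₀; step₁)

  private
    x′ = s₂ + η

    x≤x′ : suc κ + δ ≤ x′
    x≤x′ = ≤-trans (m≤m+n (suc κ + δ) (ε + 2))
      (≤-reflexive (sym (trans (eq₁ η δ) (trans (cong (λ n → n + δ + 1) (sym hyp)) (eq₂ ε κ δ)))))
      where
      eq₁ : ∀ η δ → suc (suc (η + δ)) + 1 + η ≡ 2 * suc η + δ + 1
      eq₁ = solve-∀
      eq₂ : ∀ ε κ δ → ε + suc κ + 1 + δ + 1 ≡ suc κ + δ + (ε + 2)
      eq₂ = solve-∀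

    2x′<N : 2 * x′ < ε + size₀
    2x′<N = ≤-trans (m≤m+n (suc (2 * x′)) (ε + 2 * κ + 2 * η + 4)) (≤-reflexive (eq ε κ δ η))
      where
      eq : ∀ ε κ δ η → suc (2 * (suc (suc (η + δ)) + 1 + η)) + (ε + 2 * κ + 2 * η + 4) ≡ ε + (2 * κ + 6 * η + 2 * δ + 11)
      eq = solve-∀

    x′<p : x′ < p
    x′<p = ≤-trans (m≤m+n (suc x′) (suc η + suc κ)) (≤-reflexive (eq s₂ κ η))
      where
      eq : ∀ s κ η → suc (s + η) + (suc η + suc κ) ≡ s + suc η + suc η + suc κ
      eq = solve-∀

    size-bound : suc (ε + suc size₀) ≡ 4 * ε + 5 * κ + 2 * δ + 13
    size-bound = trans (eq₁ ε κ δ η) (trans (cong (λ n → ε + 2 * κ + 3 * n + 2 * δ + 7) (sym hyp)) (eq₂ ε κ δ))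
      where
      eq₁ : ∀ ε κ δ η → suc (ε + suc (2 * κ + 6 * η + 2 * δ + 11)) ≡ ε + 2 * κ + 3 * (2 * suc η) + 2 * δ + 7
      eq₁ = solve-∀
      eq₂ : ∀ ε κ δ → ε + 2 * κ + 3 * (ε + suc κ + 1) + 2 * δ + 7 ≡ 4 * ε + 5 * κ + 2 * δ + 13
      eq₂ = solve-∀

    reflected : t₃ + suc η + x′ ≡ ε + suc size₀
    reflected = eq ε κ δ η
      where
      eq : ∀ ε κ δ η → suc (suc (η + δ)) + 1 + suc η + suc η + suc κ + suc ε + suc κ + suc η + (suc (suc (η + δ)) + 1 + η)
        ≡ ε + suc (2 * κ + 6 * η + 2 * δ + 11)
      eq = solve-∀

    x′≡ : ε + suc size₀ ∸ (t₃ + suc η) ≡ x′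
    x′≡ = trans (cong (_∸ (t₃ + suc η)) (sym reflected)) (m+n∸m≡n (t₃ + suc η) x′)

  -- The parity required by the next `k` selects `step₀` or `step₁`. The latter starts high up, but
  -- its reflection starts at the same `x′` as `step₀`.
  addCycle : ∀ {L b K M y} → Labelling L b ε (suc κ + δ) y → 3 ≤ ε → K ≤ suc κ + δ → 4 * ε + 5 * κ + 2 * δ + 13 ≤ M →
    ∀ k → State (2 * suc κ + 1 ∷ L) b K k M
  addCycle {L} {b} {K} {M} {y} G 3≤ε K≤x bound k with even⊎odd (ε + size₀ + k + 1)
  ... | h′ , inj₁ even = record
    { h         = h′
    ; labelling = step₀ 3≤ε G
    ; 3≤ε       = ≤-trans 3≤ε (m≤m+n ε size₀)
    ; K≤x       = ≤-trans K≤x x≤x′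
    ; 2x<ε      = 2x′<N
    ; x<y       = ≤-trans x′<p (m≤m+n p y)
    ; parity    = even
    ; bound     = ≤-trans (≤-trans (s≤s (+-monoʳ-≤ ε (n≤1+n size₀))) (≤-reflexive size-bound)) bound
    }
  ... | h′ , inj₂ odd = record
    { h         = suc h′
    ; labelling = subst (λ x → Labelling (2 * suc κ + 1 ∷ L) b (ε + suc size₀) x (ε + suc size₀ ∸ (p + y))) x′≡ (complement (step₁ 3≤ε G))
    ; 3≤ε       = ≤-trans 3≤ε (m≤m+n ε (suc size₀))
    ; K≤x       = ≤-trans K≤x x≤x′
    ; 2x<ε      = ≤-trans 2x′<N (+-monoʳ-≤ ε (n≤1+n size₀))
    ; x<y       = ≤-trans (s≤s (≤-reflexive (sym x′≡)))
                    (∸-monoʳ-< (≤-trans (≤-reflexive (sym (+-suc p y))) (≤-trans (+-monoʳ-≤ p (s≤s (end-≤ G)))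
                      (≤-trans (m≤m+n (p + suc ε) (suc κ)) (m≤m+n t₃ (suc η)))))
                      (≤-trans (m≤m+n (t₃ + suc η) x′) (≤-reflexive reflected)))
    ; parity    = trans (cong (λ n → n + k + 1) (+-suc ε size₀)) (trans (cong suc odd) (sym (*-suc 2 h′)))
    ; bound     = ≤-trans (≤-reflexive size-bound) bound
    }

step : ∀ {L b K k M} → State L b K k M → 1 ≤ k → k ≤ K → ∀ k′ → State (2 * k + 1 ∷ L) b K k′ (7 * M)
step {L} {b} {K} {suc κ} {M} S (s≤s z≤n) k≤K k′ with m≤n⇒∃[o]m+o≡n (≤-trans k≤K (State.K≤x S)) | State.h S in h≡
... | δ , refl | zero = contradiction (trans (sym (+-comm (State.ε S + suc κ) 1)) (trans (State.parity S) (cong (2 *_) h≡))) λ ()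
... | δ , refl | suc η = addCycle κ δ η hyp δ<h labelling 3≤ε K≤x
        -- From 2(k + δ) + 1 ≤ ε the new size is at most 7ε + 4, hence at most 7(ε + 1); for this
        -- reason a `State` bounds `suc ε`.
        (≤-trans (≤-trans (m≤m+n _ (κ + 4 * δ)) (≤-trans (≤-reflexive (eq₁ ε κ δ)) (+-monoʳ-≤ (4 * ε + 4) (*-monoʳ-≤ 3 2x<ε))))
          (≤-trans (≤-trans (m≤m+n _ 3) (≤-reflexive (eq₂ ε))) (*-monoʳ-≤ 7 bound))) k′
  where
  open State S hiding (h)
  hyp : ε + suc κ + 1 ≡ 2 * suc η
  hyp = trans parity (cong (2 *_) h≡)
  δ<h : δ < suc η
  δ<h = *-cancelˡ-< 2 δ (suc η) (subst (2 * δ <_) hyp (≤-trans (≤-trans (s≤s (*-monoʳ-≤ 2 (m≤n+m δ (suc κ)))) 2x<ε)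
    (≤-trans (m≤m+n ε (suc κ + 1)) (≤-reflexive (sym (+-assoc ε (suc κ) 1))))))
  eq₁ : ∀ ε κ δ → 4 * ε + 5 * κ + 2 * δ + 13 + (κ + 4 * δ) ≡ 4 * ε + 4 + 3 * suc (2 * (suc κ + δ))
  eq₁ = solve-∀
  eq₂ : ∀ ε → 4 * ε + 4 + 3 * ε + 3 ≡ 7 * suc ε
  eq₂ = solve-∀

-- The first cycle

cyclesAndPath : ∀ {L x y V D V′ D′ ε} → Cycles L V′ D′ → Path x y V D →
  (V′ ++ V) ≈ ((0 , suc ε) ∷ []) → (D′ ++ D) ≈ ((1 , ε) ∷ []) → Labelling L 0 ε x y
cyclesAndPath {V = V} {D} {V′} {D′} C (mkPath t e pv pd) (same vs) (same ds) = record
  { cycles    = cycles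
  ; cyclesLen = cyclesLen
  ; twoCycles = []
  ; twoLen    = refl
  ; tail      = t
  ; end       = e
  ; vertices  = ↭-trans (++⁺ vertices pv) (↭-trans (↭-reflexive (sym (⟦⟧-++ V′ V))) (↭-trans vs (↭-reflexive (++-identityʳ _))))
  ; distances = ↭-trans (++⁺ distances pd) (↭-trans (↭-reflexive (sym (⟦⟧-++ D′ D))) (↭-trans ds (↭-reflexive (++-identityʳ _))))
  }
  where open Cycles C

triangle : Labelling (3 ∷ []) 0 6 2 5
triangle = cyclesAndPath
  (close (join (single 1) (join (single 4) (single 3) 1 (down refl)) 3 (up refl)) refl 2 (down refl))
  (join (single 2) (join (single 6) (join (single 0) (single 5) 5 (up refl)) 6 (down refl)) 4 (up refl))
  (merge₁ (5 ∷ 0 ∷ 2 ∷ 1 ∷ 0 ∷ 1 ∷ []) (refl , refl , refl , refl , refl , refl , refl , refl))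
  (merge₁ (1 ∷ 1 ∷ 0 ∷ 0 ∷ 1 ∷ []) (refl , refl , refl , refl , refl , refl , refl))

module Bases (n : ℕ) where

  κ = suc n
  K = suc κ

  -- The path fills [K, 2K) with the distances below K. The vertex 2K closes the zigzag around it by
  -- the distances K and K + 1, and the zigzag uses the larger ones.
  cycle-3K : ∃ λ y → Labelling (2 * K + 1 ∷ []) 0 (3 * K) K (K + suc y)
  -- At a successor `zigzag-up` returns a successor, which puts the second end above `K`.
  cycle-3K = let y , P = zigzag-up K (suc n) in _ , cyclesAndPath
    (close (join (rev (block 0 (K + K + 1) (K + 1) K (κ + suc (κ + 0)) κ (sym (+-assoc K K 1)) refl ≤-refl))
        (single (K + K)) (K + 1) (up (link κ)))
      (length-eq κ) K (up (closing κ)))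
    P
    (merge₁ (0 ∷ 2 ∷ 1 ∷ []) (refl , refl , refl , refl , sumV κ))
    (merge₁ (3 ∷ 2 ∷ 1 ∷ []) (refl , refl , refl , +-comm 1 (K + 1) , sumD κ))
    where
    link : ∀ κ → κ + (suc κ + 1) ≡ suc κ + suc κ
    link = solve-∀
    length-eq : ∀ κ → suc κ + (suc κ + (1 + 0)) ≡ 2 * suc κ + 1
    length-eq = solve-∀
    closing : ∀ κ → suc κ + suc κ + suc κ ≡ suc κ + suc κ + 1 + κ
    closing = solve-∀
    sumV : ∀ κ → suc κ + suc κ + 1 + suc κ ≡ suc (3 * suc κ)
    sumV = solve-∀
    sumD : ∀ κ → suc (suc κ + 1) + (κ + suc (κ + 0)) ≡ 1 + 3 * suc κ
    sumD = solve-∀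

  -- The other parity: K + 1 now closes the zigzag, by K and K + 2, and the path jumps from K by K +
  -- 1 to the top of [K + 2, 2K + 1]. Offset 1 in the block requires K ≥ 2.
  cycle-3K+1 : ∃ λ y → Labelling (2 * K + 1 ∷ []) 0 (suc (3 * K)) K (K + suc y)
  cycle-3K+1 = let y , P = zigzag-down (K + 1 + 1) κ in suc y , cyclesAndPath
    (close (join (block 0 (K + 1 + 1 + K) (K + 1 + 1) K (κ + suc (κ + 0)) 1 (+-comm K (K + 1 + 1)) refl (s≤s (s≤s z≤n)))
        (single (K + 1)) (K + 1 + 1) (down (link₁ κ)))
      (length-eq κ) K (down (+-comm 1 K)))
    (cast (join (single K) P (K + 1) (up (link₂ κ))) refl (end κ y) ≈-refl ≈-refl)
    (merge₁ (0 ∷ 2 ∷ 1 ∷ 1 ∷ []) (refl , refl , refl , refl , refl , sumV κ))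
    (merge₁ (4 ∷ 2 ∷ 2 ∷ 1 ∷ []) (refl , refl , refl , refl , +-comm 1 (K + 1 + 1) , sumD κ))
    where
    link₁ : ∀ κ → suc κ + 1 + (suc κ + 1 + 1) ≡ suc κ + 1 + 1 + suc κ + 1
    link₁ = solve-∀
    length-eq : ∀ κ → suc κ + (suc κ + (1 + 0)) ≡ 2 * suc κ + 1
    length-eq = solve-∀
    link₂ : ∀ κ → suc κ + (suc κ + 1) ≡ suc κ + 1 + 1 + κ
    link₂ = solve-∀
    end : ∀ κ y → suc κ + 1 + 1 + y ≡ suc κ + suc (suc y)
    end = solve-∀
    sumV : ∀ κ → suc κ + 1 + 1 + suc κ + suc κ ≡ suc (suc (3 * suc κ))
    sumV = solve-∀
    sumD : ∀ κ → suc (suc κ + 1 + 1) + (κ + suc (κ + 0)) ≡ 1 + suc (3 * suc κ)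
    sumD = solve-∀

base₀ : ∀ K k → 1 ≤ k → k ≤ K → State (2 * K + 1 ∷ []) 0 K k (2 * (2 * K + 1) + 1)
base₀ zero k 1≤k k≤0 = contradiction (≤-trans 1≤k k≤0) λ ()
base₀ (suc zero) (suc zero) _ _ = record
  { h = 4 ; labelling = triangle ; 3≤ε = s≤s (s≤s (s≤s z≤n)) ; K≤x = s≤s z≤n ; 2x<ε = s≤s (s≤s (s≤s (s≤s (s≤s z≤n))))
  ; x<y = s≤s (s≤s (s≤s z≤n)) ; parity = refl ; bound = ≤-refl }
base₀ (suc zero) (suc (suc k)) _ (s≤s ())
base₀ (suc (suc n)) k _ _ with even⊎odd (3 * suc (suc n) + k + 1)
... | h , inj₁ even = record
  { h         = h
  ; labelling = proj₂ cycle-3K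
  ; 3≤ε       = ≤-trans (m≤m+n 3 (3 * κ)) (≤-reflexive (sym (*-suc 3 κ)))
  ; K≤x       = ≤-refl
  ; 2x<ε      = ≤-trans (m≤m+n (suc (2 * K)) κ) (≤-reflexive (eq₁ κ))
  ; x<y       = m<m+n K (s≤s z≤n)
  ; parity    = even
  ; bound     = ≤-trans (m≤m+n _ (K + 2)) (≤-reflexive (eq₂ K))
  }
  where
  open Bases n
  eq₁ : ∀ κ → suc (2 * suc κ) + κ ≡ 3 * suc κ
  eq₁ = solve-∀
  eq₂ : ∀ K → suc (3 * K) + (K + 2) ≡ 2 * (2 * K + 1) + 1
  eq₂ = solve-∀
... | h , inj₂ odd = record
  { h         = suc h
  ; labelling = proj₂ cycle-3K+1
  ; 3≤ε       = ≤-trans (m≤m+n 3 (3 * κ)) (≤-trans (≤-reflexive (sym (*-suc 3 κ))) (n≤1+n _))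
  ; K≤x       = ≤-refl
  ; 2x<ε      = ≤-trans (m≤m+n (suc (2 * K)) K) (≤-reflexive (eq₁ K))
  ; x<y       = m<m+n K (s≤s z≤n)
  ; parity    = trans (cong suc odd) (sym (*-suc 2 h))
  ; bound     = ≤-trans (m≤m+n _ (K + 1)) (≤-reflexive (eq₂ K))
  }
  where
  open Bases n
  eq₁ : ∀ K → suc (2 * K) + K ≡ suc (3 * K)
  eq₁ = solve-∀
  eq₂ : ∀ K → suc (suc (3 * K)) + (K + 1) ≡ 2 * (2 * K + 1) + 1
  eq₂ = solve-∀

twoCycle-3 : Labelling [] 1 3 1 2
twoCycle-3 = record
  { cycles    = []
  ; cyclesLen = refl
  ; twoCycles = (0 ∷ 3 ∷ []) ∷ []
  ; twoLen    = refl
  ; tail      = 2 ∷ []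
  ; end       = refl
  ; vertices  = arrange-↭ (0 ∷ 1 ∷ 1 ∷ []) ((0 , 1) ∷ (3 , 1) ∷ (1 , 1) ∷ (2 , 1) ∷ [])
  ; distances = ++-comm (3 ∷ 3 ∷ []) (1 ∷ [])
  }

twoCycle-6 : Labelling [] 1 6 1 3
twoCycle-6 = record
  { cycles    = []
  ; cyclesLen = refl
  ; twoCycles = (2 ∷ 5 ∷ []) ∷ []
  ; twoLen    = refl
  ; tail      = 6 ∷ 0 ∷ 4 ∷ 3 ∷ []
  ; end       = refl
  ; vertices  = arrange-↭ (4 ∷ 2 ∷ 0 ∷ 3 ∷ 2 ∷ 0 ∷ []) ((2 , 1) ∷ (5 , 1) ∷ (1 , 1) ∷ (6 , 1) ∷ (0 , 1) ∷ (4 , 1) ∷ (3 , 1) ∷ [])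
  ; distances = arrange-↭ (5 ∷ 0 ∷ 0 ∷ 2 ∷ 0 ∷ []) ((3 , 1) ∷ (3 , 1) ∷ (5 , 1) ∷ (6 , 1) ∷ (4 , 1) ∷ (1 , 1) ∷ [])
  }

-- After the extension the path has an end at 1; its reflection is large enough for a cycle of length 2 K + 1.
base₁ : ∀ K k → 1 ≤ k → k ≤ K → State (2 * K + 1 ∷ []) 1 K k (7 * (2 * (2 * K + 1) + 1))
base₁ K k 1≤k k≤K with even⊎odd K
... | zero  , inj₁ refl = contradiction (≤-trans 1≤k k≤K) λ ()
... | zero  , inj₂ refl = addCycle 0 0 3 refl (s≤s z≤n) twoCycle-6 (s≤s (s≤s (s≤s z≤n))) ≤-refl (m≤m+n 37 12) k
-- For even K take ε = 2K + 3, so that ε + K + 1 is even. The reflected end 2K + 2 violates the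
-- bound 2x < ε of a `State`, hence `addCycle` directly, with δ = K + 2.
... | suc i , inj₁ refl = addCycle κ (suc κ + 2) (3 * i + 4) (parity i) (≤-trans (m≤m+n _ i) (≤-reflexive (small i)))
    (subst (λ x → Labelling [] 1 (3 + 2 * suc κ) x (3 + 2 * suc κ ∸ (suc κ + 2))) (end i)
      (complement (extend twoCycle-3 (s≤s (s≤s (s≤s z≤n))) κ (s≤s (≤-trans (s≤s z≤n) (m≤n+m (suc (i + 0)) i))))))
    (s≤s (s≤s (s≤s z≤n))) (m≤m+n (suc κ) _) (≤-trans (m≤m+n _ (26 * i + 23)) (≤-reflexive (bound i))) k
  where
  κ = i + suc (i + 0)
  parity : ∀ i → 3 + 2 * suc (i + suc (i + 0)) + suc (i + suc (i + 0)) + 1 ≡ 2 * suc (3 * i + 4)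
  parity = solve-∀
  small : ∀ i → suc (suc (i + suc (i + 0)) + 2) + i ≡ suc (3 * i + 4)
  small = solve-∀
  end : ∀ i → 2 + 2 * suc (i + suc (i + 0)) ≡ suc (i + suc (i + 0)) + (suc (i + suc (i + 0)) + 2)
  end = solve-∀
  bound : ∀ i → 4 * (3 + 2 * suc (i + suc (i + 0))) + 5 * (i + suc (i + 0)) + 2 * (suc (i + suc (i + 0)) + 2) + 13 + (26 * i + 23)
    ≡ 7 * (2 * (2 * suc (i + suc (i + 0)) + 1) + 1)
  bound = solve-∀
-- For odd K take ε = 2K + 4; the reflected end is 2K + 3, so δ = K + 3.
... | suc i , inj₂ refl = addCycle κ (suc κ + 3) (3 * i + 6) (parity i) (≤-trans (m≤m+n _ i) (≤-reflexive (small i)))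
    (subst (λ x → Labelling [] 1 (6 + 2 * κ) x (6 + 2 * κ ∸ (κ + 3))) (end i)
      (complement (extend twoCycle-6 (s≤s (s≤s (s≤s z≤n))) (i + suc (i + 0)) (s≤s (≤-trans (s≤s z≤n) (m≤n+m (suc (i + 0)) i))))))
    (s≤s (s≤s (s≤s z≤n))) (m≤m+n (suc κ) _) (≤-trans (m≤m+n _ (26 * i + 30)) (≤-reflexive (bound i))) k
  where
  κ = suc (i + suc (i + 0))
  parity : ∀ i → 6 + 2 * suc (i + suc (i + 0)) + suc (suc (i + suc (i + 0))) + 1 ≡ 2 * suc (3 * i + 6)
  parity = solve-∀
  small : ∀ i → suc (suc (suc (i + suc (i + 0))) + 3) + i ≡ suc (3 * i + 6)
  small = solve-∀
  end : ∀ i → 5 + 2 * suc (i + suc (i + 0)) ≡ suc (suc (i + suc (i + 0))) + (suc (suc (i + suc (i + 0))) + 3)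
  end = solve-∀
  bound : ∀ i → 4 * (6 + 2 * suc (i + suc (i + 0))) + 5 * suc (i + suc (i + 0)) + 2 * (suc (suc (i + suc (i + 0))) + 3) + 13 + (26 * i + 30)
    ≡ 7 * (2 * (2 * suc (suc (i + suc (i + 0))) + 1) + 1)
  bound = solve-∀

-- Assembling arbitrary multisets

odds : List ℕ → List ℕ
odds = map (λ k → 2 * k + 1)

-- Each state is a function of the next `k`, because the parity must be arranged one cycle ahead.
addCycles : ∀ {L b K M} ks → All (λ k → 1 ≤ k × k ≤ K) ks → (∀ k → 1 ≤ k → k ≤ K → State L b K k M) →
  ∀ k → 1 ≤ k → k ≤ K → State (odds ks ++ L) b K k (7 ^ length ks * M)
addCycles {L} {b} {K} {M} [] [] base k 1≤k k≤K = subst (State L b K k) (sym (*-identityˡ M)) (base k 1≤k k≤K)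
addCycles {L} {b} {K} {M} (r ∷ ks) ((1≤r , r≤K) ∷ all) base k 1≤k k≤K =
  subst (State (odds (r ∷ ks) ++ L) b K k) (sym (*-assoc 7 (7 ^ length ks) M)) (step (addCycles ks all base r 1≤r r≤K) 1≤r r≤K k)

halves : ∀ {L} → All (λ ℓ → Odd ℓ × 1 < ℓ) L → ∃ λ ks → L ≡ odds ks × All (1 ≤_) ks
halves [] = [] , refl , []
halves (((zero  , refl) , s≤s ()) ∷ a)
halves (((suc k , refl) , _) ∷ a) = let ks , e , b = halves a in suc k ∷ ks , cong (2 * suc k + 1 ∷_) e , s≤s z≤n ∷ b

splitMax : ∀ k ks → ∃ λ K → ∃ λ rest → (k ∷ ks ↭ K ∷ rest) × All (_≤ K) rest
splitMax k []        = k , [] , ↭-refl , []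
splitMax k (k′ ∷ ks) with splitMax k′ ks
... | K , rest , p , a with ≤-total k K
... | inj₁ k≤K = K , k ∷ rest , ↭-trans (prep k p) (swap k K ↭-refl) , k≤K ∷ a
... | inj₂ K≤k = k , K ∷ rest , prep k p , K≤k ∷ All.map (λ q → ≤-trans q K≤k) a

≤-maxL : ∀ L → All (_≤ maxL L) L
≤-maxL []      = []
≤-maxL (ℓ ∷ L) = m≤m⊔n ℓ (maxL L) ∷ All.map (λ p → ≤-trans p (m≤n⊔m ℓ (maxL L))) (≤-maxL L)

Goal : List ℕ → ℕ → Set
Goal L a = Σ ℕ λ ε → (sum L + 2 * a + 1 ≤ ε) × (ε ≤ eps1 L a) ×
  Σ ℕ λ x → Σ ℕ λ y → GL L a (ε ∸ sum L ∸ 2 * a) x y × (2 * x ≤ ε ∸ 1) × (x < y)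

goal : ∀ {L a ε x y} → Labelling L a ε x y → ε ≤ eps1 L a → 2 * x < ε → x < y → Goal L a
goal {ε = suc ε} G bound (s≤s 2x≤ε) x<y = suc ε , path-nonempty G x<y , bound , _ , _ , toGL G , 2x≤ε , x<y

goal-odds : ∀ k ks → All (1 ≤_) (k ∷ ks) → ∀ a → a ≤ 1 → Goal (odds (k ∷ ks)) a
goal-odds k ks 1≤ a a≤1 with splitMax k ks
... | K , rest , p , rest≤K = finish a a≤1
  where
  1≤K∷rest = All-resp-↭ p 1≤
  L = odds (k ∷ ks)
  perm : odds rest ++ (2 * K + 1 ∷ []) ↭ L
  perm = ↭-trans (++-comm (odds rest) (2 * K + 1 ∷ [])) (map⁺ _ (↭-sym p))
  len : length (odds ks) ≡ length rest
  len = trans (length-map _ ks) (suc-injective (↭-length p))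
  K≤max : 2 * (2 * K + 1) + 1 ≤ 2 * maxL L + 1
  K≤max = +-monoˡ-≤ 1 (*-monoʳ-≤ 2 (All.head (All-resp-↭ (map⁺ (λ k → 2 * k + 1) p) (≤-maxL L))))
  conclude : ∀ {a M} → (∀ k → 1 ≤ k → k ≤ K → State (2 * K + 1 ∷ []) a K k M) → 7 ^ length rest * M ≤ eps1 L a → Goal L a
  conclude base bounded = goal (permute perm labelling) (≤-trans (n≤1+n _) (≤-trans bound bounded)) 2x<ε x<y
    where open State (addCycles rest (All.zip (All.tail 1≤K∷rest , rest≤K)) base K (All.head 1≤K∷rest) ≤-refl)
  finish : ∀ a → a ≤ 1 → Goal L a
  finish zero _ = conclude (base₀ K) (*-mono-≤ (≤-reflexive (cong (7 ^_) (trans (sym len) (sym (+-identityʳ _))))) K≤max)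
  -- `base₁` already carries one factor 7, which accounts for `a` in the exponent of `eps1`.
  finish (suc zero) _ = conclude (base₁ K) (≤-trans (≤-reflexive (sym (*-assoc (7 ^ length rest) 7 _)))
    (*-mono-≤ (≤-reflexive (trans (*-comm (7 ^ length rest) 7) (cong (7 ^_) (trans (cong suc (sym len)) (+-comm 1 _))))) K≤max))
  finish (suc (suc _)) (s≤s ())

edge : Labelling [] 0 1 0 1
edge = record
  { cycles = [] ; cyclesLen = refl ; twoCycles = [] ; twoLen = refl ; tail = 1 ∷ [] ; end = refl ; vertices = ↭-refl ; distances = ↭-refl }

theorem5p7 : (L : List ℕ) → All (λ ℓ → Odd ℓ × 1 < ℓ) L → (a : ℕ) → a ≤ 1 →
    Σ ℕ λ ε → (sum L + 2 * a + 1 ≤ ε) × (ε ≤ eps1 L a) ×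
    Σ ℕ λ x → Σ ℕ λ y →
    GL L a (ε ∸ sum L ∸ 2 * a) x y × (2 * x ≤ ε ∸ 1) × (x < y)
theorem5p7 L allOdd a a≤1 with halves allOdd
theorem5p7 _ _ zero             _         | [] , refl , _ = goal edge (s≤s z≤n) (s≤s z≤n) (s≤s z≤n)
theorem5p7 _ _ (suc zero)       _         | [] , refl , _ = goal twoCycle-3 ≤-refl ≤-refl ≤-refl
theorem5p7 _ _ (suc (suc _))    (s≤s ())  | [] , refl , _
theorem5p7 _ _ a                a≤1       | k ∷ ks , refl , 1≤ = goal-odds k ks 1≤ a a≤1
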